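{- Let $G$ be an OTD-admissible graph of order $n$ and let $k = \lceil \log_2 (n+1) \rceil \ge 3$. Then $\gamma^{\mathrm{OTD}}(G) = k$ if and only if $G$ can be obtained (up to isomorphism) from some graph $G^O(k) = (C \cup (V \setminus C), E)$ for which $G^O(k)[C]$ is OTD-admissible, by removing up to $2^{k-1}-1$ vertices of $V \setminus C$.
   Context: Graphs are finite, simple and undirected. For a graph $G=(V,E)$ and $v\in V$, $N(v)$ is the open neighborhood; $G[C]$ is the subgraph induced by $C$. Open twins are distinct non-adjacent vertices $u,v$ with $N(u)=N(v)$. A set $C\subseteq V$ is total-dominating if $N(v)\cap C\neq\emptyset$ for all $v\in V$, and open-separating if $N(u)\cap C\neq N(v)\cap C$ for all distinct $u,v\in V$. An OTD-code is a set that is both open-separating and total-dominating. A graph is OTD-admissible if it has an OTD-code (equivalently, it has neither isolated vertices nor open twins); $\gamma^{\mathrm{OTD}}(G)$ is the minimum cardinality of an OTD-code of $G$. For $k\ge 2$, $G^O(k)$ denotes any graph with vertex set $V$ and a subset $C\subseteq V$ such that $|C|=k$, the induced subgraph $G^O(k)[C]$ has no open twins, and $V\setminus C$ consists of exactly one vertex $v_{C'}$ with $N(v_{C'})\cap C=C'$ for each non-empty subset $C'\subseteq C$ such that there is no vertex $u\in C$ with $N(u)\cap C=C'$; there is no condition on the edges inside $V\setminus C$. -}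

module Defs where

open import Data.Bool.Base using (true; false)
open import Data.Fin.Base using (Fin; zero; suc)
open import Data.Fin.Subset
  using (Subset; ∣_∣; _∈_; _∉_; _⊆_; _∩_; ∁; Nonempty)
open import Data.Nat.Base using (ℕ; _≤_; _∸_; _^_)
open import Data.Product using (_×_; ∃; ∃-syntax; ∃!)
open import Data.Vec.Base using (_∷_; tabulate)
open import Function.Bundles using (_↔_; _⇔_; Inverse)
open import Level using (0ℓ)
open import Relation.Binary.Core using (Rel)
open import Relation.Binary.Definitions using (Decidable; Irreflexive; Symmetric)
open import Relation.Binary.PropositionalEquality using (_≡_; _≢_; cong)
open import Relation.Nullary using (¬_)
open import Relation.Nullary.Decidable using (does)

private
  variable
    m n : ℕ

record Graph (n : ℕ) : Set₁ where
  infix 4 _~_ _~?_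
  field
    _~_    : Rel (Fin n) 0ℓ
    _~?_   : Decidable _~_
    sym    : Symmetric _~_
    irrefl : Irreflexive _≡_ _~_

  N : Fin n → Subset n
  N v = tabulate λ u → does (v ~? u)

record _≅_ (G : Graph m) (H : Graph n) : Set where
  private
    module G = Graph G
    module H = Graph H
  field
    bijection : Fin m ↔ Fin n
  open Inverse bijection public using (to; from)
  field
    adjacency : ∀ u v → (u G.~ v) ⇔ (to u H.~ to v)

-- The increasing enumeration of the elements of a subset.
element : (C : Subset n) → Fin ∣ C ∣ → Fin n
element (true  ∷ C) zero    = zero
element (true  ∷ C) (suc i) = suc (element C i)
element (false ∷ C) i       = suc (element C i)

-- The subgraph induced by C, its vertices renumbered by element C.
_[_] : Graph n → (C : Subset n) → Graph ∣ C ∣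
G [ C ] = record
  { _~_    = λ i j → element C i ~ element C j
  ; _~?_   = λ i j → element C i ~? element C j
  ; sym    = sym
  ; irrefl = λ i≡j → irrefl (cong (element C) i≡j)
  }
  where open Graph G

module _ (G : Graph n) where
  open Graph G

  OpenTwins : Fin n → Fin n → Set
  OpenTwins u v = u ≢ v × ¬ (u ~ v) × N u ≡ N v

  HasNoOpenTwins : Set
  HasNoOpenTwins = ∀ u v → ¬ OpenTwins u v

  TotalDominating : Subset n → Set
  TotalDominating C = ∀ v → Nonempty (N v ∩ C)

  OpenSeparating : Subset n → Set
  OpenSeparating C = ∀ u v → u ≢ v → N u ∩ C ≢ N v ∩ C

  OTDCode : Subset n → Set
  OTDCode C = OpenSeparating C × TotalDominating C

  OTDAdmissible : Set
  OTDAdmissible = ∃ OTDCode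

  -- k is the minimum cardinality of an OTD-code.  Written as a relation,
  -- since the minimum exists only for OTD-admissible graphs.
  γᴼᵀᴰ≡ : ℕ → Set
  γᴼᵀᴰ≡ k = (∃[ C ] OTDCode C × ∣ C ∣ ≡ k) × (∀ C → OTDCode C → k ≤ ∣ C ∣)

  Unrealized : Subset n → Subset n → Set
  Unrealized C C′ =
    C′ ⊆ C × Nonempty C′ × ¬ (∃[ u ] u ∈ C × N u ∩ C ≡ C′)

module _ (G : Graph n) where
  open Graph G

  -- (G , C) is a graph Gᴼ(k).  The last two fields together say that V ∖ C
  -- consists of exactly one vertex for each unrealized C′.
  record IsGᴼ (k : ℕ) (C : Subset n) : Set where
    field
      2≤k         : 2 ≤ k
      ∣C∣≡k       : ∣ C ∣ ≡ k
      noOpenTwins : HasNoOpenTwins (G [ C ])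
      outside     : ∀ v → v ∉ C → Unrealized G C (N v ∩ C)
      unique      : ∀ C′ → Unrealized G C C′ →
                    ∃! _≡_ λ v → v ∉ C × N v ∩ C ≡ C′

ObtainedFromGᴼ : ℕ → Graph n → Set₁
ObtainedFromGᴼ k G =
  ∃[ m ] ∃[ H ] ∃[ C ] IsGᴼ {m} H k C × OTDAdmissible (H [ C ]) ×
  ∃[ R ] R ⊆ ∁ C × ∣ R ∣ ≤ 2 ^ (k ∸ 1) ∸ 1 × G ≅ (H [ ∁ R ])

{-# OPTIONS --safe #-}

-- An OTD-code C is exactly a set for which v ↦ N(v) ∩ C is an injection of the
-- vertices into the nonempty subsets of C.  Hence n + 1 ≤ 2 ^ |C|, so an
-- admissible graph always has γ ≥ ⌈log₂ (n + 1)⌉, and the pairs (H, C) that are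
-- graphs Gᴼ(k) with H[C] admissible are those for which this injection is
-- moreover onto.  Deleting vertices outside an OTD-code leaves an OTD-code, and
-- conversely a graph with an OTD-code of size k becomes a Gᴼ(k) once one vertex
-- is added for each missing subset.  At most 2 ^ (k - 1) - 1 subsets are missing
-- because n + 1 > 2 ^ (k - 1).
module Submission where

open import Data.Bool.Base using (true; false)
import Data.Bool.Properties as Bool
import Data.Empty as Empty
open import Data.Fin.Base
  using (Fin; zero; suc; _↑ˡ_; _↑ʳ_; splitAt; join; combine; funToFin; finToFun)
open import Data.Fin.Properties as Fin
  using (2↔Bool; injective⇒≤; any?; suc-injective; ↑ˡ-injective; splitAt-↑ˡ;
         splitAt-↑ʳ; join-splitAt; funToFin-finToFin; finToFun-funToFin)
open import Data.Fin.Subset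
  using (Subset; ∣_∣; _∈_; _∉_; _⊆_; _∩_; ∁; Nonempty; ⊥; ⊤)
open import Data.Fin.Subset.Properties
  using (_∈?_; _⊆?_; nonempty?; ⊆-antisym; p∩q⊆p; p∩q⊆q; x∈p∩q⁺; x∈p∩q⁻; ∉⊥; ∈⊤;
         ∣⊥∣≡0; ∣⊤∣≡n; x∈∁p⇒x∉p; x∉p⇒x∈∁p)
open import Data.Nat.Base using (ℕ; zero; suc; _+_; _∸_; _^_; _≤_; z≤n; s≤s; s≤s⁻¹)
open import Data.Nat.Logarithm using (⌈log₂_⌉; ⌈log₂⌉-mono-≤; ⌈log₂2^n⌉≡n)
open import Data.Nat.Properties
  using (≤-trans; ≤-antisym; ≰⇒>; _≤?_; 1+n≰n; +-comm; +-suc; +-identityʳ;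
         +-monoˡ-≤; +-cancelˡ-≤; m+n≤o⇒m≤o∸n; module ≤-Reasoning)
open import Data.Product using (_×_; _,_; proj₁; proj₂; ∃-syntax)
open import Data.Sum.Base using (_⊎_; inj₁; inj₂)
open import Data.Vec.Base using (_∷_; []; _++_; lookup; tabulate; here; there)
open import Data.Vec.Properties
  using (≡-dec; ++-injectiveˡ; lookup-++ˡ; lookup-++ʳ; lookup∘tabulate;
         tabulate∘lookup; tabulate-cong; []=⇒lookup; lookup⇒[]=)
open import Function.Base using (_∘_)
open import Function.Bundles using (_⇔_; mk⇔; mk↔ₛ′; Injection; Inverse; Equivalence)
open import Function.Definitions using (Injective)
open import Function.Properties.Inverse using (↔⇒↣)
open import Relation.Binary.Core using (Rel)
open import Relation.Binary.Definitions using (DecidableEquality)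
open import Relation.Binary.PropositionalEquality
  using (_≡_; _≢_; _≗_; refl; sym; trans; cong; cong₂; subst; subst₂)
open import Relation.Nullary using (¬_; Dec; yes; no; does; contradiction)
open import Relation.Nullary.Decidable
  using (dec-true; decidable-stable; _×-dec_; ¬?)
open import Relation.Unary using (Pred; Decidable)
open import Level using (0ℓ)
open import Defs

private
  variable
    m n k : ℕ

-- Subsets of `Fin n`: comprehension, concatenation, enumeration

infix 4 _≟ˢ_
_≟ˢ_ : DecidableEquality (Subset n)
_≟ˢ_ = ≡-dec Bool._≟_

comprehension : {P : Pred (Fin n) 0ℓ} → Decidable P → Subset n
comprehension P? = tabulate (does ∘ P?)

module _ {P : Pred (Fin n) 0ℓ} (P? : Decidable P) where

  ∈-comprehension⁺ : ∀ {x} → P x → x ∈ comprehension P?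
  ∈-comprehension⁺ {x} px =
    lookup⇒[]= x _ (trans (lookup∘tabulate _ x) (dec-true (P? x) px))

  ∈-comprehension⁻ : ∀ {x} → x ∈ comprehension P? → P x
  ∈-comprehension⁻ {x} x∈
    with P? x | trans (sym (lookup∘tabulate (does ∘ P?) x)) ([]=⇒lookup x∈)
  ... | yes px | _  = px
  ... | no  _  | ()

∈-++⁺ : (p : Subset m) (q : Subset n) {i : Fin m} → i ∈ p → i ↑ˡ n ∈ p ++ q
∈-++⁺ p q {i} i∈p = lookup⇒[]= _ _ (trans (lookup-++ˡ p q i) ([]=⇒lookup i∈p))

∈-++⁻ : (p : Subset m) (q : Subset n) {i : Fin m} → i ↑ˡ n ∈ p ++ q → i ∈ p
∈-++⁻ p q {i} i∈ = lookup⇒[]= _ _ (trans (sym (lookup-++ˡ p q i)) ([]=⇒lookup i∈))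

∈-++⁺ʳ : (p : Subset m) (q : Subset n) {j : Fin n} → j ∈ q → m ↑ʳ j ∈ p ++ q
∈-++⁺ʳ p q {j} j∈q = lookup⇒[]= _ _ (trans (lookup-++ʳ p q j) ([]=⇒lookup j∈q))

∈-++⁻ʳ : (p : Subset m) (q : Subset n) {j : Fin n} → m ↑ʳ j ∈ p ++ q → j ∈ q
∈-++⁻ʳ p q {j} j∈ = lookup⇒[]= _ _ (trans (sym (lookup-++ʳ p q j)) ([]=⇒lookup j∈))

∉-++⊥ : (p : Subset m) {j : Fin n} → m ↑ʳ j ∉ p ++ ⊥
∉-++⊥ p = ∉⊥ ∘ ∈-++⁻ʳ p ⊥

∣p++q∣≡∣p∣+∣q∣ : (p : Subset m) (q : Subset n) → ∣ p ++ q ∣ ≡ ∣ p ∣ + ∣ q ∣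
∣p++q∣≡∣p∣+∣q∣ []          q = refl
∣p++q∣≡∣p∣+∣q∣ (true  ∷ p) q = cong suc (∣p++q∣≡∣p∣+∣q∣ p q)
∣p++q∣≡∣p∣+∣q∣ (false ∷ p) q = ∣p++q∣≡∣p∣+∣q∣ p q

-- Matching on this view replaces an abstract vertex by a literal `i ↑ˡ n` or `m ↑ʳ j`, the shapes
-- to which the membership lemmas for `_++_` apply.
data SplitView (m : ℕ) {n : ℕ} : Fin (m + n) → Set where
  left  : (i : Fin m) → SplitView m (i ↑ˡ n)
  right : (j : Fin n) → SplitView m (m ↑ʳ j)

splitView : ∀ m {n} (v : Fin (m + n)) → SplitView m v
splitView m {n} v = subst (SplitView m) (join-splitAt m n v) (view (splitAt m v))
  where
  view : (x : Fin m ⊎ Fin n) → SplitView m (join m n x)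
  view (inj₁ i) = left i
  view (inj₂ j) = right j

element-∈ : (C : Subset n) (i : Fin ∣ C ∣) → element C i ∈ C
element-∈ (true  ∷ C) zero    = here
element-∈ (true  ∷ C) (suc i) = there (element-∈ C i)
element-∈ (false ∷ C) i       = there (element-∈ C i)

element-injective : (C : Subset n) → Injective _≡_ _≡_ (element C)
element-injective (true  ∷ C) {zero}  {zero}  _  = refl
element-injective (true  ∷ C) {suc i} {suc j} eq =
  cong suc (element-injective C (suc-injective eq))
element-injective (false ∷ C) eq = element-injective C (suc-injective eq)

index : {C : Subset n} {x : Fin n} → x ∈ C → Fin ∣ C ∣
index {C = true  ∷ C} here        = zero
index {C = true  ∷ C} (there x∈C) = suc (index x∈C)
index {C = false ∷ C} (there x∈C) = index x∈C

element-index : {C : Subset n} {x : Fin n} (x∈C : x ∈ C) →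
                element C (index x∈C) ≡ x
element-index {C = true  ∷ C} here        = refl
element-index {C = true  ∷ C} (there x∈C) = cong suc (element-index x∈C)
element-index {C = false ∷ C} (there x∈C) = cong suc (element-index x∈C)

-- Binary codes of subsets and the pigeonhole bound

funToFin-cong : {f g : Fin m → Fin n} → f ≗ g → funToFin f ≡ funToFin g
funToFin-cong {m = zero}  f≗g = refl
funToFin-cong {m = suc m} f≗g =
  cong₂ combine (f≗g zero) (funToFin-cong (f≗g ∘ suc))

private module Bit = Inverse 2↔Bool

encode : Subset n → Fin (2 ^ n)
encode p = funToFin (Bit.from ∘ lookup p)

decode : Fin (2 ^ n) → Subset n
decode j = tabulate (Bit.to ∘ finToFun j)

decode-encode : (p : Subset n) → decode (encode p) ≡ p
decode-encode p = trans
  (tabulate-cong λ i → trans (cong Bit.to (finToFun-funToFin _ i))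
                             (Bit.strictlyInverseˡ (lookup p i)))
  (tabulate∘lookup p)

encode-decode : (j : Fin (2 ^ n)) → encode {n} (decode j) ≡ j
encode-decode {n} j = trans
  -- The two digit functions agree only pointwise, so `funToFin-cong` takes the place of function
  -- extensionality.
  (funToFin-cong λ i → trans (cong Bit.from (lookup∘tabulate (Bit.to ∘ finToFun {2} {n} j) i))
                             (Bit.strictlyInverseʳ (finToFun {2} {n} j i)))
  (funToFin-finToFin {n} {2} j)

-- Recording only the bits at elements of `C` makes the pigeonhole bound `2 ^ ∣ C ∣` instead of
-- `2 ^ n`.
restrict : (C : Subset n) → Subset n → Subset ∣ C ∣
restrict C p = tabulate (lookup p ∘ element C)

restrict-⊆ : (C : Subset n) {p q : Subset n} → p ⊆ C →
             restrict C p ≡ restrict C q → p ⊆ q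
restrict-⊆ C {p} {q} p⊆C eq {x} x∈p = lookup⇒[]= x q (trans (sym x-agrees) ([]=⇒lookup x∈p))
  where
  i = index (p⊆C x∈p)
  i-agrees : lookup p (element C i) ≡ lookup q (element C i)
  i-agrees = trans (sym (lookup∘tabulate _ i))
            (trans (cong (λ r → lookup r i) eq) (lookup∘tabulate _ i))
  x-agrees : lookup p x ≡ lookup q x
  x-agrees = subst (λ y → lookup p y ≡ lookup q y) (element-index (p⊆C x∈p)) i-agrees

-- A subset of `C` is determined by its restriction, and a restriction by its binary code, so the
-- composite with `f` is still injective.
∣subsets∣≤ : (C : Subset n) (f : Fin m → Subset n) → Injective _≡_ _≡_ f →
             (∀ i → f i ⊆ C) → m ≤ 2 ^ ∣ C ∣
∣subsets∣≤ C f f-injective f⊆C = injective⇒≤ {f = encode ∘ restrict C ∘ f} λ {i} {j} eq →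
  let eq′ = trans (sym (decode-encode _)) (trans (cong decode eq) (decode-encode _))
  in f-injective (⊆-antisym (restrict-⊆ C (f⊆C i) eq′) (restrict-⊆ C (f⊆C j) (sym eq′)))

-- OTD-codes as injective trace maps, and the lower bound

module _ (G : Graph n) where
  open Graph G using (_~_; _~?_; N)

  ∈N⁺ : ∀ {u v} → u ~ v → v ∈ N u
  ∈N⁺ {u} = ∈-comprehension⁺ (u ~?_)

  ∈N⁻ : ∀ {u v} → v ∈ N u → u ~ v
  ∈N⁻ {u} = ∈-comprehension⁻ (u ~?_)

  -- Decidable equality of vertices turns the negative form of separation into injectivity.
  separating-injective : {C : Subset n} → OpenSeparating G C →
                         Injective _≡_ _≡_ (λ v → N v ∩ C)
  separating-injective sep {u} {v} eq =
    decidable-stable (u Fin.≟ v) λ u≢v → sep u v u≢v eq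

  -- Separation makes the `n` traces distinct and domination makes them nonempty, so `⊥` is one
  -- further subset of `C`; it accounts for the `suc`.
  OTDCode⇒1+n≤2^∣C∣ : {C : Subset n} → OTDCode G C → suc n ≤ 2 ^ ∣ C ∣
  OTDCode⇒1+n≤2^∣C∣ {C} (sep , dom) = ∣subsets∣≤ C f f-injective f⊆C
    where
    f : Fin (suc n) → Subset n
    f zero    = ⊥
    f (suc v) = N v ∩ C
    ⊥≢ : ∀ v → ⊥ ≢ N v ∩ C
    ⊥≢ v eq = let x , x∈ = dom v in ∉⊥ (subst (x ∈_) (sym eq) x∈)
    f-injective : Injective _≡_ _≡_ f
    f-injective {zero}  {zero}  _  = refl
    f-injective {zero}  {suc v} eq = contradiction eq (⊥≢ v)
    f-injective {suc u} {zero}  eq = contradiction (sym eq) (⊥≢ u)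
    f-injective {suc u} {suc v} eq = cong suc (separating-injective sep eq)
    f⊆C : ∀ i → f i ⊆ C
    f⊆C zero    x∈ = contradiction x∈ ∉⊥
    f⊆C (suc v) x∈ = p∩q⊆q (N v) C x∈

  ⌈log₂⌉≤∣OTDCode∣ : {C : Subset n} → OTDCode G C → ⌈log₂ (n + 1) ⌉ ≤ ∣ C ∣
  ⌈log₂⌉≤∣OTDCode∣ {C} code = subst₂ _≤_ (cong ⌈log₂_⌉ (+-comm 1 n)) (⌈log₂2^n⌉≡n ∣ C ∣)
    (⌈log₂⌉-mono-≤ (OTDCode⇒1+n≤2^∣C∣ code))

-- OTD-codes versus graphs Gᴼ(k)

module _ (G : Graph n) (C : Subset n) where
  open Graph G using (_~_; N)
  private module GC = Graph (G [ C ])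

  N-induced-⊆ : ∀ i j → N (element C i) ∩ C ⊆ N (element C j) ∩ C → GC.N i ⊆ GC.N j
  N-induced-⊆ i j sub {x} x∈ = ∈N⁺ (G [ C ])
    (∈N⁻ G (p∩q⊆p _ C (sub (x∈p∩q⁺ (∈N⁺ G (∈N⁻ (G [ C ]) x∈) , element-∈ C x)))))

  N∩C⊆-induced : ∀ i j → GC.N i ∩ ⊤ ⊆ GC.N j ∩ ⊤ → N (element C i) ∩ C ⊆ N (element C j) ∩ C
  N∩C⊆-induced i j sub {x} x∈ =
    let x∈N , x∈C = x∈p∩q⁻ _ C x∈
        y         = index x∈C
        y≡x       = element-index x∈C
        i~y       = subst (element C i ~_) (sym y≡x) (∈N⁻ G x∈N)
        y∈Nj      = p∩q⊆p _ ⊤ (sub (x∈p∩q⁺ (∈N⁺ (G [ C ]) i~y , ∈⊤)))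
    in x∈p∩q⁺ (∈N⁺ G (subst (element C j ~_) y≡x (∈N⁻ (G [ C ]) y∈Nj)) , x∈C)

  -- The neighbourhood of a vertex in `G [ C ]` is its trace on `C` renumbered, so the whole vertex
  -- set `⊤` inherits both properties.
  induced-admissible : OTDCode G C → OTDAdmissible (G [ C ])
  induced-admissible (sep , dom) = ⊤ , sep′ , dom′
    where
    sep′ : OpenSeparating (G [ C ]) ⊤
    sep′ i j i≢j eq = sep (element C i) (element C j) (i≢j ∘ element-injective C)
      (⊆-antisym (N∩C⊆-induced i j (λ {x} → subst (x ∈_) eq))
                 (N∩C⊆-induced j i (λ {x} → subst (x ∈_) (sym eq))))
    dom′ : TotalDominating (G [ C ]) ⊤
    dom′ i with dom (element C i)
    ... | x , x∈ with x∈p∩q⁻ _ C x∈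
    ...   | x∈N , x∈C = index x∈C , x∈p∩q⁺
      (∈N⁺ (G [ C ]) (subst (element C i ~_) (sym (element-index x∈C)) (∈N⁻ G x∈N)) , ∈⊤)

  -- Surjectivity of the trace map gives the existence part of `unique`. Injectivity gives its
  -- uniqueness part, and keeps the trace of an outside vertex from being realized inside `C`.
  OTDCode⇒IsGᴼ : 2 ≤ ∣ C ∣ → OTDCode G C →
    (∀ X → X ⊆ C → Nonempty X → ∃[ v ] N v ∩ C ≡ X) → IsGᴼ G ∣ C ∣ C
  OTDCode⇒IsGᴼ 2≤k code@(sep , dom) realizes = record
    { 2≤k         = 2≤k
    ; ∣C∣≡k       = refl
    ; noOpenTwins = λ i j (i≢j , _ , eq) →
        let _ , sep′ , _ = induced-admissible code
        in sep′ i j i≢j (cong (_∩ _) eq)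
    ; outside     = λ v v∉C → p∩q⊆q (N v) C , dom v , λ (u , u∈C , eq) →
        sep u v (λ u≡v → v∉C (subst (_∈ C) u≡v u∈C)) eq
    ; unique      = λ X (X⊆C , ne , unrealized) →
        let v , eq = realizes X X⊆C ne
        in v , ((λ v∈C → unrealized (v , v∈C , eq)) , eq) , λ (_ , eq′) →
           separating-injective G sep (trans eq (sym eq′))
    }

  -- Two vertices with equal traces are compared by position. The mixed case contradicts `outside`,
  -- two outside vertices contradict `unique`, and two inside vertices contradict admissibility of
  -- `G [ C ]`.
  IsGᴼ⇒OTDCode : IsGᴼ G k C → OTDAdmissible (G [ C ]) → OTDCode G C
  IsGᴼ⇒OTDCode isGᴼ (D , sepD , domD) = sep , dom
    where
    open IsGᴼ isGᴼ
    dom : TotalDominating G C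
    dom v with v ∈? C
    ... | no  v∉C = proj₁ (proj₂ (outside v v∉C))
    ... | yes v∈C with domD (index v∈C)
    ...   | x , x∈ = element C x , x∈p∩q⁺
      ( ∈N⁺ G (subst (_~ element C x) (element-index v∈C)
                (∈N⁻ (G [ C ]) (p∩q⊆p _ D x∈)))
      , element-∈ C x)
    sep : OpenSeparating G C
    sep u v u≢v eq with u ∈? C | v ∈? C
    ... | no  u∉C | yes v∈C = proj₂ (proj₂ (outside u u∉C)) (v , v∈C , sym eq)
    ... | yes u∈C | no  v∉C = proj₂ (proj₂ (outside v v∉C)) (u , u∈C , eq)
    ... | no  u∉C | no  v∉C =
      let _ , _ , uniq = unique _ (outside u u∉C)
      in u≢v (trans (sym (uniq (u∉C , refl))) (uniq (v∉C , sym eq)))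
    -- The code `D` of `G [ C ]` is arbitrary. Equal traces on `C` give equal neighbourhoods in
    -- `G [ C ]`, hence equal intersections with `D`.
    ... | yes u∈C | yes v∈C = sepD i j
      (λ i≡j → u≢v (trans (sym (element-index u∈C))
                   (trans (cong (element C) i≡j) (element-index v∈C))))
      (cong (_∩ D) (⊆-antisym (N-induced-⊆ i j (λ {x} → subst (x ∈_) eq′))
                              (N-induced-⊆ j i (λ {x} → subst (x ∈_) (sym eq′)))))
      where
      i = index u∈C
      j = index v∈C
      eq′ : N (element C i) ∩ C ≡ N (element C j) ∩ C
      eq′ = subst₂ (λ a b → N a ∩ C ≡ N b ∩ C)
        (sym (element-index u∈C)) (sym (element-index v∈C)) eq

-- Embeddings of graphs and pulling back codes

module _ (G : Graph m) (H : Graph n) (φ : Fin m → Fin n) (φ-injective : Injective _≡_ _≡_ φ)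
         (φ-adjacency : ∀ u v → Graph._~_ G u v ⇔ Graph._~_ H (φ u) (φ v)) where
  private
    module G = Graph G
    module H = Graph H

  -- `W` is the image of `φ`. Since `H [ W ]` renumbers its vertices, the isomorphism is `φ`
  -- followed by `index`, and `to-element` undoes the renumbering.
  embedding⇒≅ : (W : Subset n) → (∀ v → φ v ∈ W) → (∀ {w} → w ∈ W → ∃[ v ] φ v ≡ w) →
                G ≅ (H [ W ])
  embedding⇒≅ W φ∈W onto = record
    { bijection = mk↔ₛ′ to from
        (λ i → element-injective W (trans (to-element _) (proj₂ (onto (element-∈ W i)))))
        (λ v → φ-injective (trans (proj₂ (onto (element-∈ W (to v)))) (to-element v)))
    ; adjacency = λ u v → subst₂ (λ a b → (u G.~ v) ⇔ (a H.~ b))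
        (sym (to-element u)) (sym (to-element v)) (φ-adjacency u v)
    }
    where
    to : Fin m → Fin ∣ W ∣
    to v = index (φ∈W v)
    from : Fin ∣ W ∣ → Fin m
    from i = proj₁ (onto (element-∈ W i))
    to-element : ∀ v → element W (to v) ≡ φ v
    to-element v = element-index (φ∈W v)

  module _ (C : Subset n) where

    preimage : Subset m
    preimage = comprehension (λ v → φ v ∈? C)

    -- An inequality suffices here: the logarithmic lower bound supplies the converse for codes.
    ∣preimage∣≤ : ∣ preimage ∣ ≤ ∣ C ∣
    ∣preimage∣≤ = injective⇒≤ {f = index ∘ inC} λ {i} {j} eq →
      element-injective preimage (φ-injective
        (trans (sym (element-index (inC i)))
        (trans (cong (element C) eq) (element-index (inC j)))))
      where
      inC : ∀ i → φ (element preimage i) ∈ C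
      inC i = ∈-comprehension⁻ (λ v → φ v ∈? C) (element-∈ preimage i)

    -- As `C` lies in the image of `φ`, no element of a trace in `H` is lost when pulling back. This
    -- covers the deletion of vertices outside a code.
    preimage-OTDCode : (∀ {c} → c ∈ C → ∃[ v ] φ v ≡ c) → OTDCode H C → OTDCode G preimage
    preimage-OTDCode onto (sep , dom) = sep′ , dom′
      where
      ∈N∩⁺ : ∀ u v → φ v ∈ H.N (φ u) ∩ C → v ∈ G.N u ∩ preimage
      ∈N∩⁺ u v φv∈ = x∈p∩q⁺
        ( ∈N⁺ G (Equivalence.from (φ-adjacency u v) (∈N⁻ H (p∩q⊆p _ C φv∈)))
        , ∈-comprehension⁺ (λ w → φ w ∈? C) (p∩q⊆q _ C φv∈))
      ∈N∩⁻ : ∀ u v → v ∈ G.N u ∩ preimage → φ v ∈ H.N (φ u) ∩ C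
      ∈N∩⁻ u v v∈ = x∈p∩q⁺
        ( ∈N⁺ H (Equivalence.to (φ-adjacency u v) (∈N⁻ G (p∩q⊆p _ preimage v∈)))
        , ∈-comprehension⁻ (λ w → φ w ∈? C) (p∩q⊆q (G.N u) preimage v∈))
      transfer : ∀ u v → G.N u ∩ preimage ≡ G.N v ∩ preimage →
                 H.N (φ u) ∩ C ⊆ H.N (φ v) ∩ C
      transfer u v eq c∈ with onto (p∩q⊆q _ C c∈)
      ... | w , refl = ∈N∩⁻ v w (subst (w ∈_) eq (∈N∩⁺ u w c∈))
      sep′ : OpenSeparating G preimage
      sep′ u v u≢v eq = sep (φ u) (φ v) (u≢v ∘ φ-injective)
        (⊆-antisym (transfer u v eq) (transfer v u (sym eq)))
      dom′ : TotalDominating G preimage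
      dom′ u with dom (φ u)
      ... | c , c∈ with onto (p∩q⊆q _ C c∈)
      ...   | v , refl = v , ∈N∩⁺ u v c∈

-- Adding vertices with prescribed traces

module _ {s : ℕ} (G : Graph n) (B : Fin s → Subset n) where
  private module G = Graph G

  -- Each `j` becomes a new vertex with neighbourhood `B j`. Edges between new vertices would not
  -- change any trace on `C`, so there are none.
  Adjacent : Rel (Fin n ⊎ Fin s) 0ℓ
  Adjacent (inj₁ u) (inj₁ v) = u G.~ v
  Adjacent (inj₁ u) (inj₂ j) = u ∈ B j
  Adjacent (inj₂ i) (inj₁ v) = v ∈ B i
  Adjacent (inj₂ i) (inj₂ j) = Empty.⊥

  adjacent? : ∀ x y → Dec (Adjacent x y)
  adjacent? (inj₁ u) (inj₁ v) = u G.~? v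
  adjacent? (inj₁ u) (inj₂ j) = u ∈? B j
  adjacent? (inj₂ i) (inj₁ v) = v ∈? B i
  adjacent? (inj₂ i) (inj₂ j) = no λ ()

  adjacent-sym : ∀ x y → Adjacent x y → Adjacent y x
  adjacent-sym (inj₁ u) (inj₁ v) = G.sym
  adjacent-sym (inj₁ u) (inj₂ j) u∈ = u∈
  adjacent-sym (inj₂ i) (inj₁ v) v∈ = v∈

  adjacent-irrefl : ∀ x → ¬ Adjacent x x
  adjacent-irrefl (inj₁ u) = G.irrefl refl

  extend : Graph (n + s)
  extend = record
    { _~_    = λ u v → Adjacent (splitAt n u) (splitAt n v)
    ; _~?_   = λ u v → adjacent? (splitAt n u) (splitAt n v)
    ; sym    = λ {u} {v} → adjacent-sym (splitAt n u) (splitAt n v)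
    ; irrefl = λ { {u} refl → adjacent-irrefl (splitAt n u) }
    }

  private module E = Graph extend

  extend-adjacency : ∀ u v → (u G.~ v) ⇔ (u ↑ˡ s E.~ v ↑ˡ s)
  extend-adjacency u v rewrite splitAt-↑ˡ n u s | splitAt-↑ˡ n v s = mk⇔ (λ e → e) (λ e → e)

  extend-adjacencyʳ : ∀ j v → (v ∈ B j) ⇔ (n ↑ʳ j E.~ v ↑ˡ s)
  extend-adjacencyʳ j v rewrite splitAt-↑ʳ n s j | splitAt-↑ˡ n v s = mk⇔ (λ e → e) (λ e → e)

  module _ (C : Subset n) where

    code : Subset (n + s)
    code = C ++ ⊥

    -- `code` contains no new vertex, so only the old part `p` of `P` matters.
    ∩-code : ∀ {P : Subset (n + s)} {p : Subset n} → (∀ i → i ∈ p ⇔ i ↑ˡ s ∈ P) →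
             P ∩ code ≡ (p ∩ C) ++ ⊥
    ∩-code {P} {p} p⇔P = ⊆-antisym forth back
      where
      forth : P ∩ code ⊆ (p ∩ C) ++ ⊥
      forth {x} x∈ with splitView n x | x∈p∩q⁻ P code x∈
      ... | left i  | x∈P , x∈code = ∈-++⁺ _ _
        (x∈p∩q⁺ (Equivalence.from (p⇔P i) x∈P , ∈-++⁻ C ⊥ x∈code))
      ... | right j | _   , x∈code = contradiction x∈code (∉-++⊥ C)
      back : (p ∩ C) ++ ⊥ ⊆ P ∩ code
      back {x} x∈ with splitView n x
      ... | left i  = let i∈p , i∈C = x∈p∩q⁻ p C (∈-++⁻ _ _ x∈) in
        x∈p∩q⁺ (Equivalence.to (p⇔P i) i∈p , ∈-++⁺ C ⊥ i∈C)
      ... | right j = contradiction x∈ (∉-++⊥ (p ∩ C))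

    trace-left : ∀ u → E.N (u ↑ˡ s) ∩ code ≡ (G.N u ∩ C) ++ ⊥
    trace-left u = ∩-code λ v → mk⇔
      (∈N⁺ extend ∘ Equivalence.to (extend-adjacency u v) ∘ ∈N⁻ G)
      (∈N⁺ G ∘ Equivalence.from (extend-adjacency u v) ∘ ∈N⁻ extend)

    module _ (B⊆C : ∀ j → B j ⊆ C) where

      trace-right : ∀ j → E.N (n ↑ʳ j) ∩ code ≡ B j ++ ⊥
      trace-right j = trans
        (∩-code λ v → mk⇔
          (∈N⁺ extend ∘ Equivalence.to (extend-adjacencyʳ j v))
          (Equivalence.from (extend-adjacencyʳ j v) ∘ ∈N⁻ extend))
        (cong (_++ ⊥) (⊆-antisym (p∩q⊆p (B j) C) λ x∈ → x∈p∩q⁺ (x∈ , B⊆C j x∈)))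

      -- Collisions of traces are excluded by kind: old with old by `sep`, new with new by
      -- `B-injective`, old with new by `B-new`.
      extend-OTDCode : (∀ j → Nonempty (B j)) → Injective _≡_ _≡_ B →
                       (∀ u j → G.N u ∩ C ≢ B j) → OTDCode G C → OTDCode extend code
      extend-OTDCode B-nonempty B-injective B-new (sep , dom) = sep′ , dom′
        where
        from-left : ∀ {p q : Subset n} → p ++ ⊥ {s} ≡ q ++ ⊥ → p ≡ q
        from-left = ++-injectiveˡ _ _
        sep′ : OpenSeparating extend code
        sep′ x y x≢y eq with splitView n x | splitView n y
        ... | left u  | left v  = sep u v (x≢y ∘ cong (_↑ˡ s))
          (from-left (trans (sym (trace-left u)) (trans eq (trace-left v))))
        ... | left u  | right j = B-new u j
          (from-left (trans (sym (trace-left u)) (trans eq (trace-right j))))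
        ... | right i | left v  = B-new v i
          (from-left (trans (sym (trace-left v)) (trans (sym eq) (trace-right i))))
        ... | right i | right j = x≢y (cong (n ↑ʳ_) (B-injective
          (from-left (trans (sym (trace-right i)) (trans eq (trace-right j))))))
        dom′ : TotalDominating extend code
        dom′ x with splitView n x
        ... | left u  = let y , y∈ = dom u in
          y ↑ˡ s , subst (y ↑ˡ s ∈_) (sym (trace-left u)) (∈-++⁺ _ ⊥ y∈)
        ... | right j = let y , y∈ = B-nonempty j in
          y ↑ˡ s , subst (y ↑ˡ s ∈_) (sym (trace-right j)) (∈-++⁺ _ ⊥ y∈)

      -- A subset `Y` of `code` has the form `X ++ ⊥` with `X` its old part, which reduces the claim
      -- to subsets of `C`.
      extend-realizes : (∀ X → X ⊆ C → Nonempty X → (∃[ u ] G.N u ∩ C ≡ X) ⊎ (∃[ j ] B j ≡ X)) →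
                        ∀ Y → Y ⊆ code → Nonempty Y → ∃[ x ] E.N x ∩ code ≡ Y
      extend-realizes B-complete Y Y⊆code (y , y∈Y) = realize (B-complete X X⊆C X-nonempty)
        where
        X : Subset n
        X = comprehension (λ i → i ↑ˡ s ∈? Y)
        ∈X⁺ : ∀ {i} → i ↑ˡ s ∈ Y → i ∈ X
        ∈X⁺ = ∈-comprehension⁺ (λ i → i ↑ˡ s ∈? Y)
        ∈X⁻ : ∀ {i} → i ∈ X → i ↑ˡ s ∈ Y
        ∈X⁻ = ∈-comprehension⁻ (λ i → i ↑ˡ s ∈? Y)
        X⊆C : X ⊆ C
        X⊆C i∈X = ∈-++⁻ C ⊥ (Y⊆code (∈X⁻ i∈X))
        X-nonempty : Nonempty X
        X-nonempty with splitView n y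
        ... | left i  = i , ∈X⁺ y∈Y
        ... | right j = contradiction (Y⊆code y∈Y) (∉-++⊥ C)
        forth : X ++ ⊥ ⊆ Y
        forth {x} x∈ with splitView n x
        ... | left i  = ∈X⁻ (∈-++⁻ X ⊥ x∈)
        ... | right j = contradiction x∈ (∉-++⊥ X)
        back : Y ⊆ X ++ ⊥
        back {x} x∈ with splitView n x
        ... | left i  = ∈-++⁺ X ⊥ (∈X⁺ x∈)
        ... | right j = contradiction (Y⊆code x∈) (∉-++⊥ C)
        X++⊥≡Y : X ++ ⊥ ≡ Y
        X++⊥≡Y = ⊆-antisym forth back
        realize : (∃[ u ] G.N u ∩ C ≡ X) ⊎ (∃[ j ] B j ≡ X) → ∃[ x ] E.N x ∩ code ≡ Y
        realize (inj₁ (u , eq)) =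
          u ↑ˡ s , trans (trace-left u) (trans (cong (_++ ⊥) eq) X++⊥≡Y)
        realize (inj₂ (j , eq)) =
          n ↑ʳ j , trans (trace-right j) (trans (cong (_++ ⊥) eq) X++⊥≡Y)

-- Enumerating the subsets of `C` that are not traces

module _ (G : Graph n) (C : Subset n) where
  open Graph G using (N)

  -- In contrast to `Unrealized`, `u` ranges over all vertices: a subset that is already the trace
  -- of a vertex outside `C` must not receive a second one.
  Missing : Pred (Subset n) 0ℓ
  Missing X = X ⊆ C × Nonempty X × ¬ (∃[ u ] N u ∩ C ≡ X)

  missing? : Decidable Missing
  missing? X = X ⊆? C ×-dec nonempty? X ×-dec ¬? (any? λ u → N u ∩ C ≟ˢ X)

  -- Filtering binary codes lets `element` list the missing subsets without repetition, and their
  -- number is a cardinality.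
  missingCodes : Subset (2 ^ n)
  missingCodes = comprehension (missing? ∘ decode)

  missing : Fin ∣ missingCodes ∣ → Subset n
  missing = decode ∘ element missingCodes

  missing-injective : Injective _≡_ _≡_ missing
  missing-injective eq = element-injective missingCodes
    (trans (sym (encode-decode {n} _)) (trans (cong encode eq) (encode-decode {n} _)))

  missing-Missing : ∀ j → Missing (missing j)
  missing-Missing j = ∈-comprehension⁻ (missing? ∘ decode) (element-∈ missingCodes j)

  missing-complete : ∀ X → Missing X → ∃[ j ] missing j ≡ X
  missing-complete X X-missing = index X∈ , trans (cong decode (element-index X∈)) (decode-encode X)
    where
    X∈ : encode X ∈ missingCodes
    X∈ = ∈-comprehension⁺ (missing? ∘ decode) (subst Missing (sym (decode-encode X)) X-missing)

-- Arithmetic of the logarithm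

<⌈log₂⌉⇒2^≤ : ∀ k → suc k ≡ ⌈log₂ (n + 1) ⌉ → 2 ^ k ≤ n
<⌈log₂⌉⇒2^≤ {n} k eq with n + 1 ≤? 2 ^ k
-- By monotonicity the logarithm would be at most `k`, but it is `suc k`.
... | yes n+1≤ = contradiction
  (subst₂ _≤_ (sym eq) (⌈log₂2^n⌉≡n k) (⌈log₂⌉-mono-≤ n+1≤)) 1+n≰n
... | no  n+1≰ = s≤s⁻¹ (subst (suc (2 ^ k) ≤_) (+-comm n 1) (≰⇒> n+1≰))

-- Of the `2 ^ suc k` available places at least `2 ^ k` are taken by `n` and one more by the `suc`.
1+n+s≤2^⇒s≤ : ∀ {s} → 2 ^ k ≤ n → suc (n + s) ≤ 2 ^ suc k → s ≤ 2 ^ k ∸ 1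
1+n+s≤2^⇒s≤ {k} {n} {s} 2^k≤n bound =
  m+n≤o⇒m≤o∸n s (subst (_≤ 2 ^ k) (+-comm 1 s) (+-cancelˡ-≤ (2 ^ k) _ _ 2^k+1+s≤2^k+2^k))
  where
  open ≤-Reasoning
  2^k+1+s≤2^k+2^k : 2 ^ k + suc s ≤ 2 ^ k + 2 ^ k
  2^k+1+s≤2^k+2^k = begin
    2 ^ k + suc s         ≤⟨ +-monoˡ-≤ (suc s) 2^k≤n ⟩
    n + suc s             ≡⟨ +-suc n s ⟩
    suc (n + s)           ≤⟨ bound ⟩
    2 ^ k + (2 ^ k + 0)   ≡⟨ cong (2 ^ k +_) (+-identityʳ (2 ^ k)) ⟩
    2 ^ k + 2 ^ k         ∎

-- The two directions of the equivalence

OTDCode⇒ObtainedFromGᴼ : (G : Graph n) {C : Subset n} → OTDCode G C → 2 ≤ ∣ C ∣ →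
  ∣ C ∣ ≡ ⌈log₂ (n + 1) ⌉ → ObtainedFromGᴼ ∣ C ∣ G
OTDCode⇒ObtainedFromGᴼ {n} G {C} codeG 2≤∣C∣ eq =
  n + s , H , D , subst (λ k → IsGᴼ H k D) ∣D∣≡∣C∣ isGᴼ , induced-admissible H D codeH ,
  R , R⊆∁D , ∣R∣≤ , G≅H[∁R]
  where
  -- `H` gains one vertex per missing subset, and `R` is the set of these vertices, so deleting `R`
  -- gives `G` back.
  s = ∣ missingCodes G C ∣
  B = missing G C
  H = extend G B
  D = code G B C
  R : Subset (n + s)
  R = ⊥ {n} ++ ⊤ {s}

  B-complete : ∀ X → X ⊆ C → Nonempty X →
               (∃[ u ] Graph.N G u ∩ C ≡ X) ⊎ (∃[ j ] B j ≡ X)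
  B-complete X X⊆C ne with any? (λ u → Graph.N G u ∩ C ≟ˢ X)
  ... | yes realized   = inj₁ realized
  ... | no  unrealized = inj₂ (missing-complete G C X (X⊆C , ne , unrealized))

  B⊆C : ∀ j → B j ⊆ C
  B⊆C j = proj₁ (missing-Missing G C j)

  codeH : OTDCode H D
  codeH = extend-OTDCode G B C B⊆C
    (λ j → proj₁ (proj₂ (missing-Missing G C j)))
    (missing-injective G C)
    (λ u j eq′ → proj₂ (proj₂ (missing-Missing G C j)) (u , eq′))
    codeG

  ∣D∣≡∣C∣ : ∣ D ∣ ≡ ∣ C ∣
  ∣D∣≡∣C∣ = trans (∣p++q∣≡∣p∣+∣q∣ C ⊥)
           (trans (cong (∣ C ∣ +_) (∣⊥∣≡0 s)) (+-identityʳ ∣ C ∣))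

  isGᴼ : IsGᴼ H ∣ D ∣ D
  isGᴼ = OTDCode⇒IsGᴼ H D (subst (2 ≤_) (sym ∣D∣≡∣C∣) 2≤∣C∣) codeH
           (extend-realizes G B C B⊆C B-complete)

  left∉R : ∀ i → i ↑ˡ s ∉ R
  left∉R i = ∉⊥ ∘ ∈-++⁻ ⊥ ⊤

  right∈R : ∀ j → n ↑ʳ j ∈ R
  right∈R j = ∈-++⁺ʳ (⊥ {n}) (⊤ {s}) ∈⊤

  R⊆∁D : R ⊆ ∁ D
  R⊆∁D {x} x∈R with splitView n x
  ... | left i  = contradiction x∈R (left∉R i)
  ... | right j = x∉p⇒x∈∁p (∉-++⊥ C)

  ∣R∣≡s : ∣ R ∣ ≡ s
  ∣R∣≡s = trans (∣p++q∣≡∣p∣+∣q∣ (⊥ {n}) ⊤) (cong₂ _+_ (∣⊥∣≡0 n) (∣⊤∣≡n s))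

  ∣R∣≤ : ∣ R ∣ ≤ 2 ^ (∣ C ∣ ∸ 1) ∸ 1
  ∣R∣≤ = subst (_≤ _) (sym ∣R∣≡s)
    -- The counting bound is applied to `H`, whose order `n + s` includes the added vertices.
    (bound eq 2≤∣C∣ (subst (λ k → suc (n + s) ≤ 2 ^ k) ∣D∣≡∣C∣ (OTDCode⇒1+n≤2^∣C∣ H codeH)))
    where
    -- Generalising `∣ C ∣` to a variable allows matching on `suc k`, so that `k ∸ 1` computes.
    bound : ∀ {k} → k ≡ ⌈log₂ (n + 1) ⌉ → 2 ≤ k → suc (n + s) ≤ 2 ^ k → s ≤ 2 ^ (k ∸ 1) ∸ 1
    bound {suc k} eq _ = 1+n+s≤2^⇒s≤ {k} (<⌈log₂⌉⇒2^≤ k eq)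

  onto : ∀ {x} → x ∈ ∁ R → ∃[ v ] v ↑ˡ s ≡ x
  onto {x} x∈∁R with splitView n x
  ... | left i  = i , refl
  ... | right j = contradiction (right∈R j) (x∈∁p⇒x∉p x∈∁R)

  G≅H[∁R] : G ≅ (H [ ∁ R ])
  G≅H[∁R] = embedding⇒≅ G H (_↑ˡ s) (↑ˡ-injective s _ _) (extend-adjacency G B)
    (∁ R) (λ v → x∉p⇒x∈∁p (left∉R v)) onto

-- `R` avoids `C`, so the code `C` of `H` survives the deletion and pulls back along the embedding
-- of `G` into `H`.
ObtainedFromGᴼ⇒OTDCode : (G : Graph n) → ObtainedFromGᴼ k G → ∃[ D ] OTDCode G D × ∣ D ∣ ≤ k
ObtainedFromGᴼ⇒OTDCode {n} {k} G (m , H , C , isGᴼ , admissible , R , R⊆∁C , _ , G≅) =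
  preimage′ , preimage-OTDCode G H φ φ-injective adjacency C onto (IsGᴼ⇒OTDCode H C isGᴼ admissible) ,
  subst (∣ preimage′ ∣ ≤_) (IsGᴼ.∣C∣≡k isGᴼ) (∣preimage∣≤ G H φ φ-injective adjacency C)
  where
  open _≅_ G≅
  φ : Fin n → Fin m
  φ = element (∁ R) ∘ to
  φ-injective : Injective _≡_ _≡_ φ
  φ-injective = Injection.injective (↔⇒↣ bijection) ∘ element-injective (∁ R)
  preimage′ = preimage G H φ φ-injective adjacency C
  onto : ∀ {c} → c ∈ C → ∃[ v ] φ v ≡ c
  onto {c} c∈C = from (index c∈∁R) ,
    trans (cong (element (∁ R)) (Inverse.strictlyInverseˡ bijection _)) (element-index c∈∁R)
    where
    c∈∁R : c ∈ ∁ R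
    c∈∁R = x∉p⇒x∈∁p λ c∈R → x∈∁p⇒x∉p (R⊆∁C c∈R) c∈C

theorem5 : (n k : ℕ) (G : Graph n) → OTDAdmissible G →
    k ≡ ⌈log₂ (n + 1) ⌉ → 3 ≤ k →
    γᴼᵀᴰ≡ G k ⇔ ObtainedFromGᴼ k G
theorem5 n k G _ k≡log 3≤k = mk⇔ forth back
  where
  minimal : ∀ D → OTDCode G D → k ≤ ∣ D ∣
  minimal D codeD = subst (_≤ ∣ D ∣) (sym k≡log) (⌈log₂⌉≤∣OTDCode∣ G codeD)
  forth : γᴼᵀᴰ≡ G k → ObtainedFromGᴼ k G
  forth ((C , codeC , refl) , _) = OTDCode⇒ObtainedFromGᴼ G codeC (≤-trans (s≤s (s≤s z≤n)) 3≤k) k≡log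
  back : ObtainedFromGᴼ k G → γᴼᵀᴰ≡ G k
  back obtained = let D , codeD , ∣D∣≤k = ObtainedFromGᴼ⇒OTDCode G obtained in
    -- The logarithmic bound is used twice: it forces `∣ D ∣` up to `k`, and it is the minimality
    -- clause itself.
    (D , codeD , ≤-antisym ∣D∣≤k (minimal D codeD)) , minimal
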